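{- For all propositions $A,B,C$, variables $x,y$ and proof-terms $t_1,t_2,t_3$: if $t_1\in[\![A\odot B]\!]$, $(u/x)t_2\in[\![C]\!]$ for all $u\in[\![A]\!]$, and $(v/y)t_3\in[\![C]\!]$ for all $v\in[\![B]\!]$, then $\delta_\odot(t_1,[x]t_2,[y]t_3)\in[\![C]\!]$.
   Context: The $\odot$-calculus. Propositions: $A ::= \top \mid \bot \mid A \Rightarrow A \mid A \wedge A \mid A \vee A \mid A \odot A$. Proof-terms: $t ::= x \mid t \parallel u \mid * \mid \delta_\bot(t) \mid \lambda x\, t \mid t\,u \mid \langle t,u\rangle \mid \delta_\wedge(t,[x,y]u) \mid \mathrm{inl}(t) \mid \mathrm{inr}(t) \mid \delta_\vee(t,[x]u,[y]v) \mid t+u \mid \delta_\odot(t,[x]u,[y]v) \mid \delta_\odot^\parallel(t,[x]u,[y]v)$, where $\lambda x$ binds $x$, $[x,y]$ binds $x,y$, and $[x]$, $[y]$ bind $x$, $y$; $(u/x)t$ is capture-avoiding substitution. Ultra-reduction $\longrightarrow$ is the smallest contextual relation (closed under all term constructors) containing $\sigma l\to\sigma r$ for every substitution $\sigma$ and every rule $l\to r$ among: $(\lambda x\,t)\,u\to(u/x)t$; $\delta_\wedge(\langle t,u\rangle,[x,y]v)\to(t/x,u/y)v$; $\delta_\vee(\mathrm{inl}(t),[x]v,[y]w)\to(t/x)v$; $\delta_\vee(\mathrm{inr}(u),[x]v,[y]w)\to(u/y)w$; $\delta_\odot(t+u,[x]v,[y]w)\to(t/x)v$; $\delta_\odot(t+u,[x]v,[y]w)\to(u/y)w$;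 $\delta_\odot^\parallel(t+u,[x]v,[y]w)\to(t/x)v\parallel(u/y)w$; $(\lambda x\,t)\parallel(\lambda x\,u)\to\lambda x\,(t\parallel u)$; $\langle t,u\rangle\parallel\langle v,w\rangle\to\langle t\parallel v,u\parallel w\rangle$; $\delta_\vee(t\parallel u,[x]v,[y]w)\to\delta_\vee(t,[x]v,[y]w)\parallel\delta_\vee(u,[x]v,[y]w)$; $(t+u)\parallel(v+w)\to(t\parallel v)+(u\parallel w)$; $t\parallel t\to t$; $t\parallel u\to t$; $t\parallel u\to u$. $\longrightarrow^*$ is its reflexive-transitive closure; $t$ strongly terminates if there is no infinite ultra-reduction sequence from $t$. Sets $[\![A]\!]$ are defined by induction on $A$: $t\in[\![\top]\!]$ and $t\in[\![\bot]\!]$ iff $t$ strongly terminates; $t\in[\![A\Rightarrow B]\!]$ iff $t$ strongly terminates and whenever $t\longrightarrow^*\lambda x\,u$, then $(v/x)u\in[\![B]\!]$ for every $v\in[\![A]\!]$; $t\in[\![A\wedge B]\!]$ iff $t$ strongly terminates and whenever $t\longrightarrow^*\langle u,v\rangle$, then $u\in[\![A]\!]$ and $v\in[\![B]\!]$; $t\in[\![A\vee B]\!]$ iff $t$ strongly terminates, whenever $t\longrightarrow^*\mathrm{inl}(u)$ then $u\in[\![A]\!]$, and whenever $t\longrightarrow^*\mathrm{inr}(v)$ then $v\in[\![B]\!]$; $t\in[\![A\odot B]\!]$ iff $t$ strongly terminates and whenever $t\longrightarrow^* u+v$, then $u\in[\![A]\!]$ and $v\in[\![B]\!]$. -}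

module Defs where

open import Data.Nat using (ℕ; zero; suc)
open import Data.Product using (_×_; Σ; _,_)
open import Relation.Binary.Construct.Closure.ReflexiveTransitive using (Star)
open import Induction.WellFounded using (Acc)
open import Relation.Binary.PropositionalEquality using (_≡_)

data Form : Set where
  ⊤' ⊥' : Form
  _⇒_ _∧_ _∨_ _⊙_ : Form → Form → Form

-- Proof-terms, with de Bruijn indices for bound variables
-- (terms are identified up to α-equivalence, as in the paper).
--   lam t          : λx t           (x = index 0 in t)
--   δ∧ t u         : δ∧(t,[x,y]u)   (x = index 1, y = index 0 in u)
--   δ∨ t u v       : δ∨(t,[x]u,[y]v) (x = index 0 in u, y = index 0 in v)
--   δ⊙ t u v, δ⊙∥ t u v : likewise

data Term : Set where
  var  : ℕ → Term
  _∥_  : Term → Term → Term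
  star : Term
  δ⊥   : Term → Term
  lam  : Term → Term
  app  : Term → Term → Term
  pair : Term → Term → Term
  δ∧   : Term → Term → Term
  inl  : Term → Term
  inr  : Term → Term
  δ∨   : Term → Term → Term → Term
  _+'_ : Term → Term → Term
  δ⊙   : Term → Term → Term → Term
  δ⊙∥  : Term → Term → Term → Term

ext : (ℕ → ℕ) → ℕ → ℕ
ext ρ zero    = zero
ext ρ (suc n) = suc (ρ n)

rename : (ℕ → ℕ) → Term → Term
rename ρ (var n)     = var (ρ n)
rename ρ (t ∥ u)     = rename ρ t ∥ rename ρ u
rename ρ star        = star
rename ρ (δ⊥ t)      = δ⊥ (rename ρ t)
rename ρ (lam t)     = lam (rename (ext ρ) t)
rename ρ (app t u)   = app (rename ρ t) (rename ρ u)
rename ρ (pair t u)  = pair (rename ρ t) (rename ρ u)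
rename ρ (δ∧ t u)    = δ∧ (rename ρ t) (rename (ext (ext ρ)) u)
rename ρ (inl t)     = inl (rename ρ t)
rename ρ (inr t)     = inr (rename ρ t)
rename ρ (δ∨ t u v)  = δ∨ (rename ρ t) (rename (ext ρ) u) (rename (ext ρ) v)
rename ρ (t +' u)    = rename ρ t +' rename ρ u
rename ρ (δ⊙ t u v)  = δ⊙ (rename ρ t) (rename (ext ρ) u) (rename (ext ρ) v)
rename ρ (δ⊙∥ t u v) = δ⊙∥ (rename ρ t) (rename (ext ρ) u) (rename (ext ρ) v)

exts : (ℕ → Term) → ℕ → Term
exts σ zero    = var zero
exts σ (suc n) = rename suc (σ n)

subst : (ℕ → Term) → Term → Term
subst σ (var n)     = σ n
subst σ (t ∥ u)     = subst σ t ∥ subst σ u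
subst σ star        = star
subst σ (δ⊥ t)      = δ⊥ (subst σ t)
subst σ (lam t)     = lam (subst (exts σ) t)
subst σ (app t u)   = app (subst σ t) (subst σ u)
subst σ (pair t u)  = pair (subst σ t) (subst σ u)
subst σ (δ∧ t u)    = δ∧ (subst σ t) (subst (exts (exts σ)) u)
subst σ (inl t)     = inl (subst σ t)
subst σ (inr t)     = inr (subst σ t)
subst σ (δ∨ t u v)  = δ∨ (subst σ t) (subst (exts σ) u) (subst (exts σ) v)
subst σ (t +' u)    = subst σ t +' subst σ u
subst σ (δ⊙ t u v)  = δ⊙ (subst σ t) (subst (exts σ) u) (subst (exts σ) v)
subst σ (δ⊙∥ t u v) = δ⊙∥ (subst σ t) (subst (exts σ) u) (subst (exts σ) v)

_[_] : Term → Term → Term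
t [ u ] = subst σ t
  where
  σ : ℕ → Term
  σ zero    = u
  σ (suc n) = var n

_[_&&_] : Term → Term → Term → Term
v [ t && u ] = subst σ v
  where
  σ : ℕ → Term
  σ zero          = u
  σ (suc zero)    = t
  σ (suc (suc n)) = var n

infix 4 _⟶_ _⟶*_

data _⟶_ : Term → Term → Set where
  β⇒    : ∀ {t u} → app (lam t) u ⟶ t [ u ]
  β∧    : ∀ {t u v} → δ∧ (pair t u) v ⟶ v [ t && u ]
  β∨l   : ∀ {t v w} → δ∨ (inl t) v w ⟶ v [ t ]
  β∨r   : ∀ {u v w} → δ∨ (inr u) v w ⟶ w [ u ]
  β⊙l   : ∀ {t u v w} → δ⊙ (t +' u) v w ⟶ v [ t ]
  β⊙r   : ∀ {t u v w} → δ⊙ (t +' u) v w ⟶ w [ u ]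
  β⊙∥   : ∀ {t u v w} → δ⊙∥ (t +' u) v w ⟶ (v [ t ]) ∥ (w [ u ])
  ∥lam  : ∀ {t u} → lam t ∥ lam u ⟶ lam (t ∥ u)
  ∥pair : ∀ {t u v w} → pair t u ∥ pair v w ⟶ pair (t ∥ v) (u ∥ w)
  ∥δ∨   : ∀ {t u v w} → δ∨ (t ∥ u) v w ⟶ δ∨ t v w ∥ δ∨ u v w
  ∥+    : ∀ {t u v w} → (t +' u) ∥ (v +' w) ⟶ (t ∥ v) +' (u ∥ w)
  ∥idem : ∀ {t} → t ∥ t ⟶ t
  ∥l    : ∀ {t u} → t ∥ u ⟶ t
  ∥r    : ∀ {t u} → t ∥ u ⟶ u
  c∥₁   : ∀ {t t' u} → t ⟶ t' → t ∥ u ⟶ t' ∥ u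
  c∥₂   : ∀ {t u u'} → u ⟶ u' → t ∥ u ⟶ t ∥ u'
  cδ⊥   : ∀ {t t'} → t ⟶ t' → δ⊥ t ⟶ δ⊥ t'
  clam  : ∀ {t t'} → t ⟶ t' → lam t ⟶ lam t'
  capp₁ : ∀ {t t' u} → t ⟶ t' → app t u ⟶ app t' u
  capp₂ : ∀ {t u u'} → u ⟶ u' → app t u ⟶ app t u'
  cpair₁ : ∀ {t t' u} → t ⟶ t' → pair t u ⟶ pair t' u
  cpair₂ : ∀ {t u u'} → u ⟶ u' → pair t u ⟶ pair t u'
  cδ∧₁  : ∀ {t t' u} → t ⟶ t' → δ∧ t u ⟶ δ∧ t' u
  cδ∧₂  : ∀ {t u u'} → u ⟶ u' → δ∧ t u ⟶ δ∧ t u'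
  cinl  : ∀ {t t'} → t ⟶ t' → inl t ⟶ inl t'
  cinr  : ∀ {t t'} → t ⟶ t' → inr t ⟶ inr t'
  cδ∨₁  : ∀ {t t' u v} → t ⟶ t' → δ∨ t u v ⟶ δ∨ t' u v
  cδ∨₂  : ∀ {t u u' v} → u ⟶ u' → δ∨ t u v ⟶ δ∨ t u' v
  cδ∨₃  : ∀ {t u v v'} → v ⟶ v' → δ∨ t u v ⟶ δ∨ t u v'
  c+₁   : ∀ {t t' u} → t ⟶ t' → t +' u ⟶ t' +' u
  c+₂   : ∀ {t u u'} → u ⟶ u' → t +' u ⟶ t +' u'
  cδ⊙₁  : ∀ {t t' u v} → t ⟶ t' → δ⊙ t u v ⟶ δ⊙ t' u v
  cδ⊙₂  : ∀ {t u u' v} → u ⟶ u' → δ⊙ t u v ⟶ δ⊙ t u' v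
  cδ⊙₃  : ∀ {t u v v'} → v ⟶ v' → δ⊙ t u v ⟶ δ⊙ t u v'
  cδ⊙∥₁ : ∀ {t t' u v} → t ⟶ t' → δ⊙∥ t u v ⟶ δ⊙∥ t' u v
  cδ⊙∥₂ : ∀ {t u u' v} → u ⟶ u' → δ⊙∥ t u v ⟶ δ⊙∥ t u' v
  cδ⊙∥₃ : ∀ {t u v v'} → v ⟶ v' → δ⊙∥ t u v ⟶ δ⊙∥ t u v'

_⟶*_ : Term → Term → Set
_⟶*_ = Star _⟶_

_⟵_ : Term → Term → Set
u ⟵ t = t ⟶ u

SN : Term → Set
SN = Acc _⟵_

⟦_⟧ : Form → Term → Set
⟦ ⊤' ⟧ t    = SN t
⟦ ⊥' ⟧ t    = SN t
⟦ A ⇒ B ⟧ t = SN t × (∀ u → t ⟶* lam u → ∀ v → ⟦ A ⟧ v → ⟦ B ⟧ (u [ v ]))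
⟦ A ∧ B ⟧ t = SN t × (∀ u v → t ⟶* pair u v → ⟦ A ⟧ u × ⟦ B ⟧ v)
⟦ A ∨ B ⟧ t = SN t × (∀ u → t ⟶* inl u → ⟦ A ⟧ u)
                   × (∀ v → t ⟶* inr v → ⟦ B ⟧ v)
⟦ A ⊙ B ⟧ t = SN t × (∀ u v → t ⟶* (u +' v) → ⟦ A ⟧ u × ⟦ B ⟧ v)

{-# OPTIONS --safe #-}

-- Reducibility of δ⊙(t₁,[x]t₂,[y]t₃) follows the usual neutral-term argument: the term is not an
-- introduction, so it suffices that each of its one-step reducts is reducible, which is shown by
-- induction on the strong termination of t₁, t₂ and t₃.  A reduct either fires β⊙ on t₁ = u + v
-- itself, and then u ∈ ⟦A⟧, v ∈ ⟦B⟧ give (u/x)t₂, (v/y)t₃ ∈ ⟦C⟧; or it reduces one of t₁, t₂, t₃,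
-- and reducibility is preserved because reduction is stable under substitution.  Strong
-- termination of t₂ and t₃ comes from substituting a variable, which is reducible at every type.

module Submission where

open import Data.Nat using (ℕ; zero; suc)
open import Data.Product using (_×_; _,_; proj₁; proj₂; ∃)
open import Function using (_∘′_)
open import Induction.WellFounded using (acc; acc-inverse; module Subrelation)
open import Relation.Binary.Construct.Closure.ReflexiveTransitive using (ε; _◅_)
import Relation.Binary.Construct.On as On
open import Relation.Binary.PropositionalEquality as ≡ using (_≡_; refl; sym; trans; cong; cong₂)
open import Relation.Nullary using (¬_; contradiction)

open import Defs

cong₃ : ∀ {A B C D : Set} (f : A → B → C → D) {a a′ b b′ c c′} →
        a ≡ a′ → b ≡ b′ → c ≡ c′ → f a b c ≡ f a′ b′ c′
cong₃ f refl refl refl = refl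

-- The fusion lemmas describe the composite substitution only pointwise.

ext-∘ : ∀ {ρ₁ ρ₂ ρ} → (∀ n → ρ₁ (ρ₂ n) ≡ ρ n) → ∀ n → ext ρ₁ (ext ρ₂ n) ≡ ext ρ n
ext-∘ h zero    = refl
ext-∘ h (suc n) = cong suc (h n)

rename-rename : ∀ {ρ₁ ρ₂ ρ} → (∀ n → ρ₁ (ρ₂ n) ≡ ρ n) →
                ∀ t → rename ρ₁ (rename ρ₂ t) ≡ rename ρ t
rename-rename h (var n)     = cong var (h n)
rename-rename h (t ∥ u)     = cong₂ _∥_ (rename-rename h t) (rename-rename h u)
rename-rename h star        = refl
rename-rename h (δ⊥ t)      = cong δ⊥ (rename-rename h t)
rename-rename h (lam t)     = cong lam (rename-rename (ext-∘ h) t)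
rename-rename h (app t u)   = cong₂ app (rename-rename h t) (rename-rename h u)
rename-rename h (pair t u)  = cong₂ pair (rename-rename h t) (rename-rename h u)
rename-rename h (δ∧ t u)    = cong₂ δ∧ (rename-rename h t) (rename-rename (ext-∘ (ext-∘ h)) u)
rename-rename h (inl t)     = cong inl (rename-rename h t)
rename-rename h (inr t)     = cong inr (rename-rename h t)
rename-rename h (δ∨ t u v)  =
  cong₃ δ∨ (rename-rename h t) (rename-rename (ext-∘ h) u) (rename-rename (ext-∘ h) v)
rename-rename h (t +' u)    = cong₂ _+'_ (rename-rename h t) (rename-rename h u)
rename-rename h (δ⊙ t u v)  =
  cong₃ δ⊙ (rename-rename h t) (rename-rename (ext-∘ h) u) (rename-rename (ext-∘ h) v)
rename-rename h (δ⊙∥ t u v) =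
  cong₃ δ⊙∥ (rename-rename h t) (rename-rename (ext-∘ h) u) (rename-rename (ext-∘ h) v)

exts-ext : ∀ {σ ρ τ} → (∀ n → σ (ρ n) ≡ τ n) → ∀ n → exts σ (ext ρ n) ≡ exts τ n
exts-ext h zero    = refl
exts-ext h (suc n) = cong (rename suc) (h n)

subst-rename : ∀ {σ ρ τ} → (∀ n → σ (ρ n) ≡ τ n) →
               ∀ t → subst σ (rename ρ t) ≡ subst τ t
subst-rename h (var n)     = h n
subst-rename h (t ∥ u)     = cong₂ _∥_ (subst-rename h t) (subst-rename h u)
subst-rename h star        = refl
subst-rename h (δ⊥ t)      = cong δ⊥ (subst-rename h t)
subst-rename h (lam t)     = cong lam (subst-rename (exts-ext h) t)
subst-rename h (app t u)   = cong₂ app (subst-rename h t) (subst-rename h u)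
subst-rename h (pair t u)  = cong₂ pair (subst-rename h t) (subst-rename h u)
subst-rename h (δ∧ t u)    = cong₂ δ∧ (subst-rename h t) (subst-rename (exts-ext (exts-ext h)) u)
subst-rename h (inl t)     = cong inl (subst-rename h t)
subst-rename h (inr t)     = cong inr (subst-rename h t)
subst-rename h (δ∨ t u v)  =
  cong₃ δ∨ (subst-rename h t) (subst-rename (exts-ext h) u) (subst-rename (exts-ext h) v)
subst-rename h (t +' u)    = cong₂ _+'_ (subst-rename h t) (subst-rename h u)
subst-rename h (δ⊙ t u v)  =
  cong₃ δ⊙ (subst-rename h t) (subst-rename (exts-ext h) u) (subst-rename (exts-ext h) v)
subst-rename h (δ⊙∥ t u v) =
  cong₃ δ⊙∥ (subst-rename h t) (subst-rename (exts-ext h) u) (subst-rename (exts-ext h) v)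

ext-exts : ∀ {ρ σ τ} → (∀ n → rename ρ (σ n) ≡ τ n) →
           ∀ n → rename (ext ρ) (exts σ n) ≡ exts τ n
ext-exts         h zero    = refl
ext-exts {ρ} {σ} h (suc n) = begin
  rename (ext ρ) (rename suc (σ n))  ≡⟨ rename-rename (λ _ → refl) (σ n) ⟩
  rename (λ k → suc (ρ k)) (σ n)     ≡⟨ sym (rename-rename (λ _ → refl) (σ n)) ⟩
  rename suc (rename ρ (σ n))        ≡⟨ cong (rename suc) (h n) ⟩
  rename suc _                       ∎
  where open ≡.≡-Reasoning

rename-subst : ∀ {ρ σ τ} → (∀ n → rename ρ (σ n) ≡ τ n) →
               ∀ t → rename ρ (subst σ t) ≡ subst τ t
rename-subst h (var n)     = h n
rename-subst h (t ∥ u)     = cong₂ _∥_ (rename-subst h t) (rename-subst h u)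
rename-subst h star        = refl
rename-subst h (δ⊥ t)      = cong δ⊥ (rename-subst h t)
rename-subst h (lam t)     = cong lam (rename-subst (ext-exts h) t)
rename-subst h (app t u)   = cong₂ app (rename-subst h t) (rename-subst h u)
rename-subst h (pair t u)  = cong₂ pair (rename-subst h t) (rename-subst h u)
rename-subst h (δ∧ t u)    = cong₂ δ∧ (rename-subst h t) (rename-subst (ext-exts (ext-exts h)) u)
rename-subst h (inl t)     = cong inl (rename-subst h t)
rename-subst h (inr t)     = cong inr (rename-subst h t)
rename-subst h (δ∨ t u v)  =
  cong₃ δ∨ (rename-subst h t) (rename-subst (ext-exts h) u) (rename-subst (ext-exts h) v)
rename-subst h (t +' u)    = cong₂ _+'_ (rename-subst h t) (rename-subst h u)
rename-subst h (δ⊙ t u v)  =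
  cong₃ δ⊙ (rename-subst h t) (rename-subst (ext-exts h) u) (rename-subst (ext-exts h) v)
rename-subst h (δ⊙∥ t u v) =
  cong₃ δ⊙∥ (rename-subst h t) (rename-subst (ext-exts h) u) (rename-subst (ext-exts h) v)

exts-exts : ∀ {σ₁ σ₂ σ} → (∀ n → subst σ₁ (σ₂ n) ≡ σ n) →
            ∀ n → subst (exts σ₁) (exts σ₂ n) ≡ exts σ n
exts-exts           h zero    = refl
exts-exts {σ₁} {σ₂} h (suc n) = begin
  subst (exts σ₁) (rename suc (σ₂ n))  ≡⟨ subst-rename (λ _ → refl) (σ₂ n) ⟩
  subst (λ k → rename suc (σ₁ k)) (σ₂ n) ≡⟨ sym (rename-subst (λ _ → refl) (σ₂ n)) ⟩
  rename suc (subst σ₁ (σ₂ n))         ≡⟨ cong (rename suc) (h n) ⟩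
  rename suc _                         ∎
  where open ≡.≡-Reasoning

subst-subst : ∀ {σ₁ σ₂ σ} → (∀ n → subst σ₁ (σ₂ n) ≡ σ n) →
              ∀ t → subst σ₁ (subst σ₂ t) ≡ subst σ t
subst-subst h (var n)     = h n
subst-subst h (t ∥ u)     = cong₂ _∥_ (subst-subst h t) (subst-subst h u)
subst-subst h star        = refl
subst-subst h (δ⊥ t)      = cong δ⊥ (subst-subst h t)
subst-subst h (lam t)     = cong lam (subst-subst (exts-exts h) t)
subst-subst h (app t u)   = cong₂ app (subst-subst h t) (subst-subst h u)
subst-subst h (pair t u)  = cong₂ pair (subst-subst h t) (subst-subst h u)
subst-subst h (δ∧ t u)    = cong₂ δ∧ (subst-subst h t) (subst-subst (exts-exts (exts-exts h)) u)
subst-subst h (inl t)     = cong inl (subst-subst h t)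
subst-subst h (inr t)     = cong inr (subst-subst h t)
subst-subst h (δ∨ t u v)  =
  cong₃ δ∨ (subst-subst h t) (subst-subst (exts-exts h) u) (subst-subst (exts-exts h) v)
subst-subst h (t +' u)    = cong₂ _+'_ (subst-subst h t) (subst-subst h u)
subst-subst h (δ⊙ t u v)  =
  cong₃ δ⊙ (subst-subst h t) (subst-subst (exts-exts h) u) (subst-subst (exts-exts h) v)
subst-subst h (δ⊙∥ t u v) =
  cong₃ δ⊙∥ (subst-subst h t) (subst-subst (exts-exts h) u) (subst-subst (exts-exts h) v)

exts-var : ∀ {σ} → (∀ n → σ n ≡ var n) → ∀ n → exts σ n ≡ var n
exts-var h zero    = refl
exts-var h (suc n) = cong (rename suc) (h n)

subst-var : ∀ {σ} → (∀ n → σ n ≡ var n) → ∀ t → subst σ t ≡ t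
subst-var h (var n)     = h n
subst-var h (t ∥ u)     = cong₂ _∥_ (subst-var h t) (subst-var h u)
subst-var h star        = refl
subst-var h (δ⊥ t)      = cong δ⊥ (subst-var h t)
subst-var h (lam t)     = cong lam (subst-var (exts-var h) t)
subst-var h (app t u)   = cong₂ app (subst-var h t) (subst-var h u)
subst-var h (pair t u)  = cong₂ pair (subst-var h t) (subst-var h u)
subst-var h (δ∧ t u)    = cong₂ δ∧ (subst-var h t) (subst-var (exts-var (exts-var h)) u)
subst-var h (inl t)     = cong inl (subst-var h t)
subst-var h (inr t)     = cong inr (subst-var h t)
subst-var h (δ∨ t u v)  = cong₃ δ∨ (subst-var h t) (subst-var (exts-var h) u) (subst-var (exts-var h) v)
subst-var h (t +' u)    = cong₂ _+'_ (subst-var h t) (subst-var h u)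
subst-var h (δ⊙ t u v)  = cong₃ δ⊙ (subst-var h t) (subst-var (exts-var h) u) (subst-var (exts-var h) v)
subst-var h (δ⊙∥ t u v) = cong₃ δ⊙∥ (subst-var h t) (subst-var (exts-var h) u) (subst-var (exts-var h) v)

subst-weaken : ∀ {σ} → (∀ n → σ (suc n) ≡ var n) → ∀ t → subst σ (rename suc t) ≡ t
subst-weaken h t = trans (subst-rename h t) (subst-var (λ _ → refl) t)

subst-[] : ∀ σ t u → subst σ (t [ u ]) ≡ subst (exts σ) t [ subst σ u ]
subst-[] σ t u = trans (subst-subst {σ = τ} (λ { zero → refl ; (suc n) → refl }) t)
  (sym (subst-subst (λ { zero → refl ; (suc n) → subst-weaken (λ _ → refl) (σ n) }) t))
  where
  τ : ℕ → Term
  τ zero    = subst σ u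
  τ (suc n) = σ n

subst-[&&] : ∀ σ v t u →
             subst σ (v [ t && u ]) ≡ subst (exts (exts σ)) v [ subst σ t && subst σ u ]
subst-[&&] σ v t u =
  trans (subst-subst {σ = τ} (λ { zero → refl ; (suc zero) → refl ; (suc (suc n)) → refl }) v)
        (sym (subst-subst (λ { zero → refl ; (suc zero) → refl ; (suc (suc n)) → dropTwo n }) v))
  where
  τ : ℕ → Term
  τ zero          = subst σ u
  τ (suc zero)    = subst σ t
  τ (suc (suc n)) = σ n
  dropTwo : ∀ n → subst _ (rename suc (rename suc (σ n))) ≡ σ n
  dropTwo n = trans (subst-rename (λ _ → refl) (rename suc (σ n))) (subst-weaken (λ _ → refl) (σ n))

⟶-≡ : ∀ {t u v} → t ⟶ u → v ≡ u → t ⟶ v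
⟶-≡ s refl = s

⟶-subst : ∀ σ {t t′} → t ⟶ t′ → subst σ t ⟶ subst σ t′
⟶-subst σ (β⇒ {t} {u})          = ⟶-≡ β⇒ (subst-[] σ t u)
⟶-subst σ (β∧ {t} {u} {v})      = ⟶-≡ β∧ (subst-[&&] σ v t u)
⟶-subst σ (β∨l {t} {v})         = ⟶-≡ β∨l (subst-[] σ v t)
⟶-subst σ (β∨r {u} {w = w})     = ⟶-≡ β∨r (subst-[] σ w u)
⟶-subst σ (β⊙l {t} {v = v})     = ⟶-≡ β⊙l (subst-[] σ v t)
⟶-subst σ (β⊙r {u = u} {w = w}) = ⟶-≡ β⊙r (subst-[] σ w u)
⟶-subst σ (β⊙∥ {t} {u} {v} {w}) =
  ⟶-≡ β⊙∥ (cong₂ _∥_ (subst-[] σ v t) (subst-[] σ w u))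
⟶-subst σ ∥lam       = ∥lam
⟶-subst σ ∥pair      = ∥pair
⟶-subst σ ∥δ∨        = ∥δ∨
⟶-subst σ ∥+         = ∥+
⟶-subst σ ∥idem      = ∥idem
⟶-subst σ ∥l         = ∥l
⟶-subst σ ∥r         = ∥r
⟶-subst σ (c∥₁ s)    = c∥₁ (⟶-subst σ s)
⟶-subst σ (c∥₂ s)    = c∥₂ (⟶-subst σ s)
⟶-subst σ (cδ⊥ s)    = cδ⊥ (⟶-subst σ s)
⟶-subst σ (clam s)   = clam (⟶-subst (exts σ) s)
⟶-subst σ (capp₁ s)  = capp₁ (⟶-subst σ s)
⟶-subst σ (capp₂ s)  = capp₂ (⟶-subst σ s)
⟶-subst σ (cpair₁ s) = cpair₁ (⟶-subst σ s)
⟶-subst σ (cpair₂ s) = cpair₂ (⟶-subst σ s)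
⟶-subst σ (cδ∧₁ s)   = cδ∧₁ (⟶-subst σ s)
⟶-subst σ (cδ∧₂ s)   = cδ∧₂ (⟶-subst (exts (exts σ)) s)
⟶-subst σ (cinl s)   = cinl (⟶-subst σ s)
⟶-subst σ (cinr s)   = cinr (⟶-subst σ s)
⟶-subst σ (cδ∨₁ s)   = cδ∨₁ (⟶-subst σ s)
⟶-subst σ (cδ∨₂ s)   = cδ∨₂ (⟶-subst (exts σ) s)
⟶-subst σ (cδ∨₃ s)   = cδ∨₃ (⟶-subst (exts σ) s)
⟶-subst σ (c+₁ s)    = c+₁ (⟶-subst σ s)
⟶-subst σ (c+₂ s)    = c+₂ (⟶-subst σ s)
⟶-subst σ (cδ⊙₁ s)   = cδ⊙₁ (⟶-subst σ s)
⟶-subst σ (cδ⊙₂ s)   = cδ⊙₂ (⟶-subst (exts σ) s)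
⟶-subst σ (cδ⊙₃ s)   = cδ⊙₃ (⟶-subst (exts σ) s)
⟶-subst σ (cδ⊙∥₁ s)  = cδ⊙∥₁ (⟶-subst σ s)
⟶-subst σ (cδ⊙∥₂ s)  = cδ⊙∥₂ (⟶-subst (exts σ) s)
⟶-subst σ (cδ⊙∥₃ s)  = cδ⊙∥₃ (⟶-subst (exts σ) s)

⟶-[] : ∀ {t t′} u → t ⟶ t′ → t [ u ] ⟶ t′ [ u ]
⟶-[] u = ⟶-subst _

SN-unsubst : ∀ σ {t} → SN (subst σ t) → SN t
SN-unsubst σ = Subrelation.accessible (⟶-subst σ) ∘′ On.accessible (subst σ)

data Intro : Term → Set where
  lam  : ∀ {t} → Intro (lam t)
  pair : ∀ {t u} → Intro (pair t u)
  inl  : ∀ {t} → Intro (inl t)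
  inr  : ∀ {t} → Intro (inr t)
  _+'_ : ∀ {t u} → Intro (t +' u)

⟶*-first-step : ∀ {t v} → ¬ Intro t → Intro v → t ⟶* v → ∃ λ t′ → t ⟶ t′ × t′ ⟶* v
⟶*-first-step ¬t v ε       = contradiction v ¬t
⟶*-first-step ¬t v (s ◅ r) = _ , s , r

⟦⟧⇒SN : ∀ C {t} → ⟦ C ⟧ t → SN t
⟦⟧⇒SN ⊤'      h = h
⟦⟧⇒SN ⊥'      h = h
⟦⟧⇒SN (A ⇒ B) h = proj₁ h
⟦⟧⇒SN (A ∧ B) h = proj₁ h
⟦⟧⇒SN (A ∨ B) h = proj₁ h
⟦⟧⇒SN (A ⊙ B) h = proj₁ h

⟦⟧-⟶ : ∀ C {t t′} → ⟦ C ⟧ t → t ⟶ t′ → ⟦ C ⟧ t′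
⟦⟧-⟶ ⊤' sn s = acc-inverse sn s
⟦⟧-⟶ ⊥' sn s = acc-inverse sn s
⟦⟧-⟶ (A ⇒ B) (sn , f) s = acc-inverse sn s , λ u r → f u (s ◅ r)
⟦⟧-⟶ (A ∧ B) (sn , f) s = acc-inverse sn s , λ u v r → f u v (s ◅ r)
⟦⟧-⟶ (A ∨ B) (sn , f , g) s = acc-inverse sn s , (λ u r → f u (s ◅ r)) , (λ v r → g v (s ◅ r))
⟦⟧-⟶ (A ⊙ B) (sn , f) s = acc-inverse sn s , λ u v r → f u v (s ◅ r)

⟦⟧-non-intro : ∀ C {t} → ¬ Intro t → (∀ {t′} → t ⟶ t′ → ⟦ C ⟧ t′) → ⟦ C ⟧ t
⟦⟧-non-intro ⊤'      ¬t h = acc h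
⟦⟧-non-intro ⊥'      ¬t h = acc h
⟦⟧-non-intro (A ⇒ B) ¬t h = acc (proj₁ ∘′ h) , λ u r →
  let _ , s , r′ = ⟶*-first-step ¬t lam r in proj₂ (h s) u r′
⟦⟧-non-intro (A ∧ B) ¬t h = acc (proj₁ ∘′ h) , λ u v r →
  let _ , s , r′ = ⟶*-first-step ¬t pair r in proj₂ (h s) u v r′
⟦⟧-non-intro (A ∨ B) ¬t h = acc (proj₁ ∘′ h) ,
  (λ u r → let _ , s , r′ = ⟶*-first-step ¬t inl r in proj₁ (proj₂ (h s)) u r′) ,
  (λ v r → let _ , s , r′ = ⟶*-first-step ¬t inr r in proj₂ (proj₂ (h s)) v r′)
⟦⟧-non-intro (A ⊙ B) ¬t h = acc (proj₁ ∘′ h) , λ u v r →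
  let _ , s , r′ = ⟶*-first-step ¬t _+'_ r in proj₂ (h s) u v r′

var∈⟦⟧ : ∀ C n → ⟦ C ⟧ (var n)
var∈⟦⟧ C n = ⟦⟧-non-intro C (λ ()) (λ ())

SN-body : ∀ A C t → (∀ u → ⟦ A ⟧ u → ⟦ C ⟧ (t [ u ])) → SN t
SN-body A C t h = SN-unsubst _ (⟦⟧⇒SN C (h (var 0) (var∈⟦⟧ A 0)))

δ⊙∈⟦⟧ : ∀ A B C {t₁ t₂ t₃} → SN t₁ → SN t₂ → SN t₃
        → ⟦ A ⊙ B ⟧ t₁
        → (∀ u → ⟦ A ⟧ u → ⟦ C ⟧ (t₂ [ u ]))
        → (∀ v → ⟦ B ⟧ v → ⟦ C ⟧ (t₃ [ v ]))
        → ⟦ C ⟧ (δ⊙ t₁ t₂ t₃)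
δ⊙∈⟦⟧ A B C {t₁} {t₂} {t₃} sn₁@(acc r₁) sn₂@(acc r₂) sn₃@(acc r₃) h₁ h₂ h₃ =
  ⟦⟧-non-intro C (λ ()) reduct
  where
  reduct : ∀ {t′} → δ⊙ t₁ t₂ t₃ ⟶ t′ → ⟦ C ⟧ t′
  reduct β⊙l      = h₂ _ (proj₁ (proj₂ h₁ _ _ ε))
  reduct β⊙r      = h₃ _ (proj₂ (proj₂ h₁ _ _ ε))
  reduct (cδ⊙₁ s) = δ⊙∈⟦⟧ A B C (r₁ s) sn₂ sn₃ (⟦⟧-⟶ (A ⊙ B) h₁ s) h₂ h₃
  reduct (cδ⊙₂ s) = δ⊙∈⟦⟧ A B C sn₁ (r₂ s) sn₃ h₁ (λ u hu → ⟦⟧-⟶ C (h₂ u hu) (⟶-[] u s)) h₃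
  reduct (cδ⊙₃ s) = δ⊙∈⟦⟧ A B C sn₁ sn₂ (r₃ s) h₁ h₂ (λ v hv → ⟦⟧-⟶ C (h₃ v hv) (⟶-[] v s))

mainTheorem10 : ∀ (A B C : Form) (t₁ t₂ t₃ : Term)
    → ⟦ A ⊙ B ⟧ t₁
    → (∀ u → ⟦ A ⟧ u → ⟦ C ⟧ (t₂ [ u ]))
    → (∀ v → ⟦ B ⟧ v → ⟦ C ⟧ (t₃ [ v ]))
    → ⟦ C ⟧ (δ⊙ t₁ t₂ t₃)
mainTheorem10 A B C t₁ t₂ t₃ h₁ h₂ h₃ =
  δ⊙∈⟦⟧ A B C (⟦⟧⇒SN (A ⊙ B) h₁) (SN-body A C t₂ h₂) (SN-body B C t₃ h₃) h₁ h₂ h₃
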